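{- Let $a_0,a_1,\alpha,\beta,u,v\in\mathbb{R}$ with $\alpha\beta\neq 0$, $uv\neq 0$ and $|a_0|+|a_1|\neq 0$, and let $(a_{n,k})_{0\le k\le n}$ be the binary binomial interpolated triangle with parameters $(a_0,a_1,\alpha,\beta;u,v)$. Let $\bar{s}_n=\sum_{k=0}^{n}(-1)^k a_{n,k}$ be the alternating sum of the entries of row $n$. Then the sequence $(\bar{s}_n)_{n\ge 0}$ satisfies the fourth order linear homogeneous recurrence $$\bar{s}_{n} = (\alpha-\mathcal{A})\bar{s}_{n-1}+(\beta+\alpha \mathcal{A}+\mathcal{B})\bar{s}_{n-2}-(\alpha \mathcal{B}-\beta \mathcal{A})\bar{s}_{n-3}-\beta \mathcal{B}\, \bar{s}_{n-4}\qquad\text{for all } n\ge 4,$$ where $\mathcal{A}=u\alpha+2v$ and $\mathcal{B}=u^2\beta-uv\alpha-v^2$.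
   Context: The binary binomial interpolated triangle with parameters $(a_0,a_1,\alpha,\beta;u,v)$ is the array of real numbers $a_{n,k}$ ($0\le k\le n$) defined as follows. Its left diagonal is $a_{n,0}=a_n$, where $(a_n)_{n\ge0}$ has initial values $a_0,a_1$ and satisfies $a_n=\alpha a_{n-1}+\beta a_{n-2}$ for $n\ge 2$. The other entries are given by $a_{n,k}=u\,a_{n,k-1}+v\,a_{n-1,k-1}$ for $1\le k\le n$. -}

module Defs where

open import Algebra.Bundles using (CommutativeRing; Semiring)
open import Algebra.Structures using (IsCommutativeRing)
open import Data.Fin.Base using (Fin; toℕ)
open import Data.Nat.Base as ℕ using (ℕ; zero; suc; _⊔_)
import Data.Nat.Properties as ℕ
open import Data.Product.Base using (∃-syntax; _×_; _,_)
open import Data.Rational.Base as ℚ using (ℚ; 0ℚ; 1ℚ; ½)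
import Data.Rational.Properties as ℚ
open import Data.Rational.Solver using (module +-*-Solver)
open import Data.Sum.Base using (inj₁; inj₂)
open import Level using (0ℓ)
open import Relation.Binary.PropositionalEquality
open import Relation.Binary.Structures using (IsEquivalence)
open import Relation.Nullary.Negation.Core using (¬_)

private

  ∣p-q∣≡∣q-p∣ : ∀ p q → ℚ.∣ p ℚ.- q ∣ ≡ ℚ.∣ q ℚ.- p ∣
  ∣p-q∣≡∣q-p∣ p q = trans (sym (ℚ.∣-p∣≡∣p∣ (p ℚ.- q)))
    (cong ℚ.∣_∣ (solve 2 (λ a b → :- (a :- b) := b :- a) refl p q))
    where
    open +-*-Solver

  ∣p-p∣<ε : ∀ p {ε} → 0ℚ ℚ.< ε → ℚ.∣ p ℚ.- p ∣ ℚ.< ε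
  ∣p-p∣<ε p 0<ε = subst (ℚ._< _) (cong ℚ.∣_∣ (sym (ℚ.+-inverseʳ p))) 0<ε

  ∣p∣-∣q∣≤∣p-q∣ : ∀ p q → ℚ.∣ p ∣ ℚ.- ℚ.∣ q ∣ ℚ.≤ ℚ.∣ p ℚ.- q ∣
  ∣p∣-∣q∣≤∣p-q∣ p q = begin
    ℚ.∣ p ∣ ℚ.- ℚ.∣ q ∣
      ≡⟨ cong (λ r → ℚ.∣ r ∣ ℚ.- ℚ.∣ q ∣) (solve 2 (λ a b → a := (a :- b) :+ b) refl p q) ⟩
    ℚ.∣ (p ℚ.- q) ℚ.+ q ∣ ℚ.- ℚ.∣ q ∣
      ≤⟨ ℚ.+-monoˡ-≤ (ℚ.- ℚ.∣ q ∣) (ℚ.∣p+q∣≤∣p∣+∣q∣ (p ℚ.- q) q) ⟩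
    (ℚ.∣ p ℚ.- q ∣ ℚ.+ ℚ.∣ q ∣) ℚ.- ℚ.∣ q ∣
      ≡⟨ solve 2 (λ a b → (a :+ b) :- b := a) refl ℚ.∣ p ℚ.- q ∣ ℚ.∣ q ∣ ⟩
    ℚ.∣ p ℚ.- q ∣ ∎
    where
    open ℚ.≤-Reasoning
    open +-*-Solver

  ∣-close : ∀ p q {ε} → ℚ.∣ p ℚ.- q ∣ ℚ.< ε → ℚ.∣ ℚ.∣ p ∣ ℚ.- ℚ.∣ q ∣ ∣ ℚ.< ε
  ∣-close p q {ε} lt with ℚ.∣p∣≡p∨∣p∣≡-p (ℚ.∣ p ∣ ℚ.- ℚ.∣ q ∣)
  ... | inj₁ eq = ℚ.≤-<-trans (subst (ℚ._≤ ℚ.∣ p ℚ.- q ∣) (sym eq) (∣p∣-∣q∣≤∣p-q∣ p q)) lt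
  ... | inj₂ eq = ℚ.≤-<-trans
    (subst₂ ℚ._≤_ (trans (solve 2 (λ a b → b :- a := :- (a :- b)) refl ℚ.∣ p ∣ ℚ.∣ q ∣) (sym eq))
      (∣p-q∣≡∣q-p∣ q p) (∣p∣-∣q∣≤∣p-q∣ q p)) lt
    where
    open +-*-Solver

  neg-close : ∀ p q {ε} → ℚ.∣ p ℚ.- q ∣ ℚ.< ε → ℚ.∣ ℚ.- p ℚ.- ℚ.- q ∣ ℚ.< ε
  neg-close p q = subst (ℚ._< _) (trans (∣p-q∣≡∣q-p∣ p q)
    (cong ℚ.∣_∣ (solve 2 (λ a b → b :- a := :- a :- :- b) refl p q)))
    where
    open +-*-Solver

  +-close : ∀ p p′ q q′ {δ} → ℚ.∣ p ℚ.- p′ ∣ ℚ.< δ → ℚ.∣ q ℚ.- q′ ∣ ℚ.< δ →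
            ℚ.∣ (p ℚ.+ q) ℚ.- (p′ ℚ.+ q′) ∣ ℚ.< δ ℚ.+ δ
  +-close p p′ q q′ {δ} p~p′ q~q′ = begin-strict
    ℚ.∣ (p ℚ.+ q) ℚ.- (p′ ℚ.+ q′) ∣
      ≡⟨ cong ℚ.∣_∣ (solve 4 (λ a a′ b b′ → (a :+ b) :- (a′ :+ b′) := (a :- a′) :+ (b :- b′))
           refl p p′ q q′) ⟩
    ℚ.∣ (p ℚ.- p′) ℚ.+ (q ℚ.- q′) ∣
      ≤⟨ ℚ.∣p+q∣≤∣p∣+∣q∣ (p ℚ.- p′) (q ℚ.- q′) ⟩
    ℚ.∣ p ℚ.- p′ ∣ ℚ.+ ℚ.∣ q ℚ.- q′ ∣
      <⟨ ℚ.+-mono-< p~p′ q~q′ ⟩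
    δ ℚ.+ δ ∎
    where
    open ℚ.≤-Reasoning
    open +-*-Solver

  ∣*∣-mono-< : ∀ p q {B δ} → 0ℚ ℚ.< B → ℚ.∣ p ∣ ℚ.< B → ℚ.∣ q ∣ ℚ.< δ → ℚ.∣ p ℚ.* q ∣ ℚ.< B ℚ.* δ
  ∣*∣-mono-< p q {B} {δ} 0<B p<B q<δ = begin-strict
    ℚ.∣ p ℚ.* q ∣         ≡⟨ ℚ.∣p*q∣≡∣p∣*∣q∣ p q ⟩
    ℚ.∣ p ∣ ℚ.* ℚ.∣ q ∣   ≤⟨ ℚ.*-monoʳ-≤-nonNeg ℚ.∣ q ∣ {{ℚ.∣-∣-nonNeg q}} (ℚ.<⇒≤ p<B) ⟩
    B ℚ.* ℚ.∣ q ∣         <⟨ ℚ.*-monoʳ-<-pos B {{ℚ.positive 0<B}} q<δ ⟩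
    B ℚ.* δ ∎
    where
    open ℚ.≤-Reasoning

  *-close : ∀ p p′ q q′ {B δ} → 0ℚ ℚ.< B → ℚ.∣ p ∣ ℚ.< B → ℚ.∣ q′ ∣ ℚ.< B →
            ℚ.∣ p ℚ.- p′ ∣ ℚ.< δ → ℚ.∣ q ℚ.- q′ ∣ ℚ.< δ →
            ℚ.∣ (p ℚ.* q) ℚ.- (p′ ℚ.* q′) ∣ ℚ.< B ℚ.* δ ℚ.+ B ℚ.* δ
  *-close p p′ q q′ {B} {δ} 0<B p<B q′<B p~p′ q~q′ = begin-strict
    ℚ.∣ (p ℚ.* q) ℚ.- (p′ ℚ.* q′) ∣
      ≡⟨ cong ℚ.∣_∣ (solve 4 (λ a a′ b b′ →
           (a :* b) :- (a′ :* b′) := a :* (b :- b′) :+ b′ :* (a :- a′)) refl p p′ q q′) ⟩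
    ℚ.∣ p ℚ.* (q ℚ.- q′) ℚ.+ q′ ℚ.* (p ℚ.- p′) ∣
      ≤⟨ ℚ.∣p+q∣≤∣p∣+∣q∣ (p ℚ.* (q ℚ.- q′)) (q′ ℚ.* (p ℚ.- p′)) ⟩
    ℚ.∣ p ℚ.* (q ℚ.- q′) ∣ ℚ.+ ℚ.∣ q′ ℚ.* (p ℚ.- p′) ∣
      <⟨ ℚ.+-mono-< (∣*∣-mono-< p (q ℚ.- q′) 0<B p<B q~q′)
                    (∣*∣-mono-< q′ (p ℚ.- p′) 0<B q′<B p~p′) ⟩
    B ℚ.* δ ℚ.+ B ℚ.* δ ∎
    where
    open ℚ.≤-Reasoning
    open +-*-Solver

  <-+ʳ : ∀ p q {r} → r ℚ.< p → 0ℚ ℚ.≤ q → r ℚ.< p ℚ.+ q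
  <-+ʳ p q {r} r<p 0≤q = subst (ℚ._< p ℚ.+ q) (ℚ.+-identityʳ r) (ℚ.+-mono-<-≤ {r} {p} {0ℚ} {q} r<p 0≤q)

  <-+ˡ : ∀ p q {r} → 0ℚ ℚ.≤ p → r ℚ.< q → r ℚ.< p ℚ.+ q
  <-+ˡ p q {r} 0≤p r<q = subst (r ℚ.<_) (ℚ.+-comm q p) (<-+ʳ q p r<q 0≤p)

  ∣p∣<ε+∣q∣ : ∀ p q {ε} → ℚ.∣ p ℚ.- q ∣ ℚ.< ε → ℚ.∣ p ∣ ℚ.< ε ℚ.+ ℚ.∣ q ∣
  ∣p∣<ε+∣q∣ p q {ε} p~q = begin-strict
    ℚ.∣ p ∣                     ≡⟨ cong ℚ.∣_∣ (solve 2 (λ a b → a := (a :- b) :+ b) refl p q) ⟩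
    ℚ.∣ (p ℚ.- q) ℚ.+ q ∣       ≤⟨ ℚ.∣p+q∣≤∣p∣+∣q∣ (p ℚ.- q) q ⟩
    ℚ.∣ p ℚ.- q ∣ ℚ.+ ℚ.∣ q ∣   <⟨ ℚ.+-monoˡ-< ℚ.∣ q ∣ p~q ⟩
    ε ℚ.+ ℚ.∣ q ∣ ∎
    where
    open ℚ.≤-Reasoning
    open +-*-Solver

  opaque
    halve : ∀ ε → 0ℚ ℚ.< ε → ∃[ δ ] (0ℚ ℚ.< δ × δ ℚ.+ δ ≡ ε)
    halve ε 0<ε = ½ ℚ.* ε
      , subst (ℚ._< ½ ℚ.* ε) (ℚ.*-zeroʳ ½) (ℚ.*-monoʳ-<-pos ½ 0<ε)
      , trans (sym (ℚ.*-distribʳ-+ ε ½ ½)) (ℚ.*-identityˡ ε)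

  opaque
    divide : ∀ B → 0ℚ ℚ.< B → ∀ ε → 0ℚ ℚ.< ε → ∃[ δ ] (0ℚ ℚ.< δ × B ℚ.* δ ≡ ε)
    divide B 0<B ε 0<ε = B⁻¹ ℚ.* ε
      , subst (ℚ._< B⁻¹ ℚ.* ε) (ℚ.*-zeroʳ B⁻¹) (ℚ.*-monoʳ-<-pos B⁻¹ {{ℚ.1/pos⇒pos B}} 0<ε)
      , trans (sym (ℚ.*-assoc B B⁻¹ ε)) (trans (cong (ℚ._* ε) (ℚ.*-inverseʳ B)) (ℚ.*-identityˡ ε))
      where
      instance
        B>0 : ℚ.Positive B
        B>0 = ℚ.positive 0<B
        B≢0 : ℚ.NonZero B
        B≢0 = ℚ.pos⇒nonZero B
      B⁻¹ : ℚ
      B⁻¹ = ℚ.1/ B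

-- The real numbers: Cauchy sequences of rationals, compared by the setoid
-- equality "the difference tends to 0".

IsCauchy : (ℕ → ℚ) → Set
IsCauchy s = ∀ ε → 0ℚ ℚ.< ε → ∃[ N ] (∀ m n → N ℕ.≤ m → N ℕ.≤ n → ℚ.∣ s m ℚ.- s n ∣ ℚ.< ε)

record ℝ : Set where
  constructor mkℝ
  field
    seq      : ℕ → ℚ
    isCauchy : IsCauchy seq
open ℝ public

infix  4 _≈_ _≉_
infixl 6 _+_ _-_
infixl 7 _*_
infix  8 -_

record _≈_ (x y : ℝ) : Set where
  constructor mk≈
  field
    close : ∀ ε → 0ℚ ℚ.< ε → ∃[ N ] (∀ n → N ℕ.≤ n → ℚ.∣ seq x n ℚ.- seq y n ∣ ℚ.< ε)
open _≈_ public

_≉_ : ℝ → ℝ → Set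
x ≉ y = ¬ (x ≈ y)

private

  -- The modulus and bound computations are opaque because normalising them
  -- unfolds rational arithmetic and makes with-abstraction intractable.
  opaque
    eventuallyBounded : ∀ x → ∃[ B ] (0ℚ ℚ.< B × ∃[ N ] (∀ n → N ℕ.≤ n → ℚ.∣ seq x n ∣ ℚ.< B))
    eventuallyBounded x = bound 1ℚ (ℚ.positive⁻¹ 1ℚ)
      where
      bound : ∀ ε → 0ℚ ℚ.< ε → ∃[ B ] (0ℚ ℚ.< B × ∃[ N ] (∀ n → N ℕ.≤ n → ℚ.∣ seq x n ∣ ℚ.< B))
      bound ε 0<ε with isCauchy x ε 0<ε
      ... | N , c = ε ℚ.+ ℚ.∣ seq x N ∣
        , <-+ʳ ε ℚ.∣ seq x N ∣ 0<ε (ℚ.0≤∣p∣ (seq x N))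
        , N , λ n N≤n → ∣p∣<ε+∣q∣ (seq x n) (seq x N) (c n N N≤n ℕ.≤-refl)

  opaque
    commonBound : ∀ x y → ∃[ B ] (0ℚ ℚ.< B × ∃[ N ] (∀ n → N ℕ.≤ n →
                  ℚ.∣ seq x n ∣ ℚ.< B × ℚ.∣ seq y n ∣ ℚ.< B))
    commonBound x y with eventuallyBounded x | eventuallyBounded y
    ... | B , 0<B , M , b | C , 0<C , N , c =
      B ℚ.+ C , <-+ʳ B C 0<B (ℚ.<⇒≤ 0<C) , M ⊔ N , λ n h →
        <-+ʳ B C (b n (ℕ.m⊔n≤o⇒m≤o M N h)) (ℚ.<⇒≤ 0<C) ,
        <-+ˡ B C (ℚ.<⇒≤ 0<B) (c n (ℕ.m⊔n≤o⇒n≤o M N h))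

  opaque
    const-isCauchy : ∀ p → IsCauchy (λ _ → p)
    const-isCauchy p ε 0<ε = 0 , λ _ _ _ _ → ∣p-p∣<ε p 0<ε

  opaque
    +-isCauchy : ∀ x y → IsCauchy (λ n → seq x n ℚ.+ seq y n)
    +-isCauchy x y ε 0<ε with halve ε 0<ε
    ... | δ , 0<δ , refl with isCauchy x δ 0<δ | isCauchy y δ 0<δ
    ... | M , c | N , d = M ⊔ N , λ m n h k →
      +-close (seq x m) (seq x n) (seq y m) (seq y n)
        (c m n (ℕ.m⊔n≤o⇒m≤o M N h) (ℕ.m⊔n≤o⇒m≤o M N k))
        (d m n (ℕ.m⊔n≤o⇒n≤o M N h) (ℕ.m⊔n≤o⇒n≤o M N k))

  opaque
    neg-isCauchy : ∀ x → IsCauchy (λ n → ℚ.- seq x n)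
    neg-isCauchy x ε 0<ε with isCauchy x ε 0<ε
    ... | N , c = N , λ m n h k → neg-close (seq x m) (seq x n) (c m n h k)

  opaque
    *-isCauchy : ∀ x y → IsCauchy (λ n → seq x n ℚ.* seq y n)
    *-isCauchy x y ε 0<ε with commonBound x y | halve ε 0<ε
    ... | B , 0<B , L , b | ε/2 , 0<ε/2 , refl with divide B 0<B ε/2 0<ε/2
    ... | δ , 0<δ , refl with isCauchy x δ 0<δ | isCauchy y δ 0<δ
    ... | M , c | N , d = L ⊔ (M ⊔ N) , λ m n h k →
      let h′ = ℕ.m⊔n≤o⇒n≤o L (M ⊔ N) h
          k′ = ℕ.m⊔n≤o⇒n≤o L (M ⊔ N) k
          (x<B , _) = b m (ℕ.m⊔n≤o⇒m≤o L (M ⊔ N) h)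
          (_ , y<B) = b n (ℕ.m⊔n≤o⇒m≤o L (M ⊔ N) k)
      in *-close (seq x m) (seq x n) (seq y m) (seq y n) 0<B x<B y<B
           (c m n (ℕ.m⊔n≤o⇒m≤o M N h′) (ℕ.m⊔n≤o⇒m≤o M N k′))
           (d m n (ℕ.m⊔n≤o⇒n≤o M N h′) (ℕ.m⊔n≤o⇒n≤o M N k′))

  opaque
    ∣-∣-isCauchy : ∀ x → IsCauchy (λ n → ℚ.∣ seq x n ∣)
    ∣-∣-isCauchy x ε 0<ε with isCauchy x ε 0<ε
    ... | N , c = N , λ m n h k → ∣-close (seq x m) (seq x n) (c m n h k)

fromℚ : ℚ → ℝ
fromℚ p = mkℝ (λ _ → p) (const-isCauchy p)

0ℝ 1ℝ : ℝ
0ℝ = fromℚ 0ℚ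
1ℝ = fromℚ 1ℚ

_+_ : ℝ → ℝ → ℝ
x + y = mkℝ (λ n → seq x n ℚ.+ seq y n) (+-isCauchy x y)

-_ : ℝ → ℝ
- x = mkℝ (λ n → ℚ.- seq x n) (neg-isCauchy x)

_-_ : ℝ → ℝ → ℝ
x - y = x + (- y)

_*_ : ℝ → ℝ → ℝ
x * y = mkℝ (λ n → seq x n ℚ.* seq y n) (*-isCauchy x y)

∣_∣ : ℝ → ℝ
∣ x ∣ = mkℝ (λ n → ℚ.∣ seq x n ∣) (∣-∣-isCauchy x)

pointwise : ∀ {x y} → (∀ n → seq x n ≡ seq y n) → x ≈ y
pointwise {x} {y} eq = mk≈ λ ε 0<ε → 0 , λ n _ →
  subst (λ p → ℚ.∣ seq x n ℚ.- p ∣ ℚ.< ε) (eq n) (∣p-p∣<ε (seq x n) 0<ε)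

≈-isEquivalence : IsEquivalence _≈_
≈-isEquivalence = record
  { refl  = pointwise λ _ → refl
  ; sym   = λ {x} {y} x≈y → mk≈ λ ε 0<ε → let N , c = close x≈y ε 0<ε in
              N , λ n h → subst (ℚ._< ε) (∣p-q∣≡∣q-p∣ (seq x n) (seq y n)) (c n h)
  ; trans = ≈-trans
  }
  where
  open +-*-Solver
  ≈-trans : ∀ {x y z} → x ≈ y → y ≈ z → x ≈ z
  ≈-trans {x} {y} {z} x≈y y≈z = mk≈ go
    where
    go : ∀ ε → 0ℚ ℚ.< ε → ∃[ N ] (∀ n → N ℕ.≤ n → ℚ.∣ seq x n ℚ.- seq z n ∣ ℚ.< ε)
    go ε 0<ε with halve ε 0<ε
    ... | δ , 0<δ , refl with close x≈y δ 0<δ | close y≈z δ 0<δ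
    ... | M , c | N , d = M ⊔ N , λ n h →
      subst (λ p → ℚ.∣ p ∣ ℚ.< δ ℚ.+ δ)
        (solve 3 (λ a b c → (a :+ b) :- (b :+ c) := a :- c) refl (seq x n) (seq y n) (seq z n))
        (+-close (seq x n) (seq y n) (seq y n) (seq z n)
          (c n (ℕ.m⊔n≤o⇒m≤o M N h)) (d n (ℕ.m⊔n≤o⇒n≤o M N h)))

+-cong : ∀ {x x′ y y′} → x ≈ x′ → y ≈ y′ → x + y ≈ x′ + y′
+-cong {x} {x′} {y} {y′} x≈x′ y≈y′ = mk≈ go
  where
  go : ∀ ε → 0ℚ ℚ.< ε → ∃[ N ] (∀ n → N ℕ.≤ n →
       ℚ.∣ seq (x + y) n ℚ.- seq (x′ + y′) n ∣ ℚ.< ε)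
  go ε 0<ε with halve ε 0<ε
  ... | δ , 0<δ , refl with close x≈x′ δ 0<δ | close y≈y′ δ 0<δ
  ... | M , c | N , d = M ⊔ N , λ n h →
    +-close (seq x n) (seq x′ n) (seq y n) (seq y′ n)
      (c n (ℕ.m⊔n≤o⇒m≤o M N h)) (d n (ℕ.m⊔n≤o⇒n≤o M N h))

-‿cong : ∀ {x y} → x ≈ y → - x ≈ - y
-‿cong {x} {y} x≈y = mk≈ λ ε 0<ε → let N , c = close x≈y ε 0<ε in
  N , λ n h → neg-close (seq x n) (seq y n) (c n h)

*-cong : ∀ {x x′ y y′} → x ≈ x′ → y ≈ y′ → x * y ≈ x′ * y′
*-cong {x} {x′} {y} {y′} x≈x′ y≈y′ = mk≈ go
  where
  go : ∀ ε → 0ℚ ℚ.< ε → ∃[ N ] (∀ n → N ℕ.≤ n →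
       ℚ.∣ seq (x * y) n ℚ.- seq (x′ * y′) n ∣ ℚ.< ε)
  go ε 0<ε with commonBound x y′ | halve ε 0<ε
  ... | B , 0<B , L , b | ε/2 , 0<ε/2 , refl with divide B 0<B ε/2 0<ε/2
  ... | δ , 0<δ , refl with close x≈x′ δ 0<δ | close y≈y′ δ 0<δ
  ... | M , c | N , d = L ⊔ (M ⊔ N) , λ n h →
    let h′ = ℕ.m⊔n≤o⇒n≤o L (M ⊔ N) h
        (x<B , y′<B) = b n (ℕ.m⊔n≤o⇒m≤o L (M ⊔ N) h)
    in *-close (seq x n) (seq x′ n) (seq y n) (seq y′ n) 0<B x<B y′<B
         (c n (ℕ.m⊔n≤o⇒m≤o M N h′)) (d n (ℕ.m⊔n≤o⇒n≤o M N h′))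

∣-∣-cong : ∀ {x y} → x ≈ y → ∣ x ∣ ≈ ∣ y ∣
∣-∣-cong {x} {y} x≈y = mk≈ λ ε 0<ε → let N , c = close x≈y ε 0<ε in
  N , λ n h → ∣-close (seq x n) (seq y n) (c n h)

+-*-isCommutativeRing : IsCommutativeRing _≈_ _+_ _*_ -_ 0ℝ 1ℝ
+-*-isCommutativeRing = record
  { isRing = record
    { +-isAbelianGroup = record
      { isGroup = record
        { isMonoid = record
          { isSemigroup = record
            { isMagma = record { isEquivalence = ≈-isEquivalence ; ∙-cong = +-cong }
            ; assoc   = λ x y z → pointwise λ n → ℚ.+-assoc (seq x n) (seq y n) (seq z n)
            }
          ; identity = (λ x → pointwise λ n → ℚ.+-identityˡ (seq x n))
                     , (λ x → pointwise λ n → ℚ.+-identityʳ (seq x n))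
          }
        ; inverse = (λ x → pointwise λ n → ℚ.+-inverseˡ (seq x n))
                  , (λ x → pointwise λ n → ℚ.+-inverseʳ (seq x n))
        ; ⁻¹-cong = -‿cong
        }
      ; comm = λ x y → pointwise λ n → ℚ.+-comm (seq x n) (seq y n)
      }
    ; *-cong     = *-cong
    ; *-assoc    = λ x y z → pointwise λ n → ℚ.*-assoc (seq x n) (seq y n) (seq z n)
    ; *-identity = (λ x → pointwise λ n → ℚ.*-identityˡ (seq x n))
                 , (λ x → pointwise λ n → ℚ.*-identityʳ (seq x n))
    ; distrib    = (λ x y z → pointwise λ n → ℚ.*-distribˡ-+ (seq x n) (seq y n) (seq z n))
                 , (λ x y z → pointwise λ n → ℚ.*-distribʳ-+ (seq x n) (seq y n) (seq z n))
    }
  ; *-comm = λ x y → pointwise λ n → ℚ.*-comm (seq x n) (seq y n)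
  }

+-*-commutativeRing : CommutativeRing 0ℓ 0ℓ
+-*-commutativeRing = record { isCommutativeRing = +-*-isCommutativeRing }

open import Algebra.Definitions.RawSemiring
  (Semiring.rawSemiring (CommutativeRing.semiring +-*-commutativeRing)) public using (_^_; sum)

2ℝ : ℝ
2ℝ = 1ℝ + 1ℝ

module BinaryBinomialInterpolatedTriangle (a₀ a₁ α β u v : ℝ) where

  leftDiagonal : ℕ → ℝ
  leftDiagonal 0             = a₀
  leftDiagonal 1             = a₁
  leftDiagonal (suc (suc n)) = α * leftDiagonal (suc n) + β * leftDiagonal n

  -- Only the entries with k ≤ n belong to the triangle.  The value 0ℝ in
  -- the clause for row 0 is a placeholder on which none of them depends.
  entry : (n k : ℕ) → ℝ
  entry n       zero    = leftDiagonal n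
  entry zero    (suc k) = 0ℝ
  entry (suc n) (suc k) = u * entry (suc n) k + v * entry n k

  alternatingRowSum : ℕ → ℝ
  alternatingRowSum n = sum λ (k : Fin (suc n)) → (- 1ℝ) ^ toℕ k * entry n (toℕ k)

{-# OPTIONS --safe #-}
-- Down each column k the rows n ≥ k inherit the recurrence of the left
-- diagonal.  Hence s̄ (n + 2) - α s̄ (n + 1) - β s̄ n only involves entries on the
-- diagonals p n = entry n n and q n = entry (n + 1) n.  Since
--   p (n + 1) = v p n + u q n,   q (n + 1) = u β p n + (u α + v) q n,
-- a system with trace 𝓐 and determinant - 𝓑, this difference, which carries the
-- sign (-1)ⁿ⁺¹, satisfies the recurrence with characteristic polynomial
-- z² + 𝓐 z - 𝓑, and s̄ the one with (z² - α z - β) (z² + 𝓐 z - 𝓑).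
module Submission where

open import Defs
open import Algebra.Bundles using (CommutativeRing)
import Algebra.Solver.Ring
open import Algebra.Solver.Ring.AlmostCommutativeRing
  using (AlmostCommutativeRing; fromCommutativeRing; _-Raw-AlmostCommutative⟶_)
open import Data.Fin.Base using (toℕ)
open import Data.Maybe.Base using (Maybe)
import Data.Maybe.Base as Maybe
open import Data.Nat.Base as ℕ using (ℕ; zero; suc; _≤_; z≤n; s≤s; _≥_; _∸_)
import Data.Nat.Properties as ℕ
open import Data.Rational.Base using (0ℚ; 1ℚ)
import Data.Rational.Properties as ℚ
open import Function.Base using (_∘_)
import Relation.Binary.PropositionalEquality as ≡
import Relation.Binary.Reasoning.Setoid as ≈-Reasoning
open import Relation.Nullary.Decidable.Core using (dec⇒maybe)

open CommutativeRing +-*-commutativeRing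
  using (setoid; refl; sym; trans; reflexive; +-congˡ; +-congʳ; +-comm; +-assoc; *-congˡ)

private
  almostCommutativeRing : AlmostCommutativeRing _ _
  almostCommutativeRing = fromCommutativeRing +-*-commutativeRing

  fromℚ-homomorphism : CommutativeRing.rawRing ℚ.+-*-commutativeRing
                       -Raw-AlmostCommutative⟶ almostCommutativeRing
  fromℚ-homomorphism = record
    { ⟦_⟧    = fromℚ
    ; +-homo = λ _ _ → pointwise λ _ → ≡.refl
    ; *-homo = λ _ _ → pointwise λ _ → ≡.refl
    ; -‿homo = λ _ → pointwise λ _ → ≡.refl
    ; 0-homo = refl
    ; 1-homo = refl
    }

  -- Equality on ℝ is undecidable, so the coefficients are taken in ℚ.
  module ℝ-Solver = Algebra.Solver.Ring _ almostCommutativeRing fromℚ-homomorphism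
    (λ p q → Maybe.map (reflexive ∘ ≡.cong fromℚ) (dec⇒maybe (p ℚ.≟ q)))

open ℝ-Solver using (Polynomial; solve; con; _:+_; _:*_; _:-_; :-_; _:=_)

-- `sum` unfolds at its first index, whereas rows are split here at their last entries.
sum-last : ∀ (f : ℕ → ℝ) m → sum {suc m} (f ∘ toℕ) ≈ sum {m} (f ∘ toℕ) + f m
sum-last f zero    = +-comm (f 0) 0ℝ
sum-last f (suc m) = trans (+-congˡ (sum-last (f ∘ suc) m)) (sym (+-assoc _ _ _))

module _ (a₀ a₁ α β u v : ℝ) where
  open BinaryBinomialInterpolatedTriangle a₀ a₁ α β u v
  open ≈-Reasoning setoid

  private
    𝓐 𝓑 : ℝ
    𝓐 = u * α + 2ℝ * v
    𝓑 = u ^ 2 * β - u * v * α - v ^ 2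

    -- Solver syntax for `𝓐` and `𝓑`, with 2 and the squares spelled out as they unfold, so that
    -- evaluation returns both definitionally.
    :𝓐 : ∀ {m} (a u v : Polynomial m) → Polynomial m
    :𝓐 a u v = u :* a :+ (con 1ℚ :+ con 1ℚ) :* v

    :𝓑 : ∀ {m} (a b u v : Polynomial m) → Polynomial m
    :𝓑 a b u v = (u :* (u :* con 1ℚ)) :* b :- u :* v :* a :- v :* (v :* con 1ℚ)

  -- Column `k + 1` is a fixed linear combination of column `k` and its shift by one row, so a
  -- linear recurrence passes from column to column.
  entry-recurrence : ∀ {n k} → k ≤ n →
                     entry (2 ℕ.+ n) k ≈ α * entry (suc n) k + β * entry n k
  entry-recurrence z≤n = refl
  entry-recurrence {suc n} {suc k} (s≤s k≤n) = begin
    u * entry (3 ℕ.+ n) k + v * entry (2 ℕ.+ n) k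
      ≈⟨ +-cong (*-congˡ (entry-recurrence (ℕ.m≤n⇒m≤1+n k≤n))) (*-congˡ (entry-recurrence k≤n)) ⟩
    u * (α * entry (2 ℕ.+ n) k + β * entry (suc n) k) + v * (α * entry (suc n) k + β * entry n k)
      ≈⟨ solve 7 (λ a b u v x y z →
           u :* (a :* x :+ b :* y) :+ v :* (a :* y :+ b :* z) :=
           a :* (u :* x :+ v :* y) :+ b :* (u :* y :+ v :* z)) refl
           α β u v (entry (2 ℕ.+ n) k) (entry (suc n) k) (entry n k) ⟩
    α * entry (2 ℕ.+ n) (suc k) + β * entry (suc n) (suc k) ∎

  signedEntry : ℕ → ℕ → ℝ
  signedEntry n k = (- 1ℝ) ^ k * entry n k

  -- Consecutive rows differ in length; cutting them at a common `m` lets them be compared column by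
  -- column.
  partialRowSum : ℕ → ℕ → ℝ
  partialRowSum n m = sum {m} (signedEntry n ∘ toℕ)

  partialRowSum-recurrence : ∀ {n} m → m ≤ suc n →
    partialRowSum (2 ℕ.+ n) m ≈ α * partialRowSum (suc n) m + β * partialRowSum n m
  partialRowSum-recurrence zero _ =
    solve 2 (λ a b → con 0ℚ := a :* con 0ℚ :+ b :* con 0ℚ) refl α β
  partialRowSum-recurrence {n} (suc m) (s≤s m≤n) = begin
    partialRowSum (2 ℕ.+ n) (suc m)
      ≈⟨ sum-last (signedEntry (2 ℕ.+ n)) m ⟩
    partialRowSum (2 ℕ.+ n) m + σ * entry (2 ℕ.+ n) m
      ≈⟨ +-cong (partialRowSum-recurrence m (ℕ.m≤n⇒m≤1+n m≤n)) (*-congˡ (entry-recurrence m≤n)) ⟩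
    (α * partialRowSum (suc n) m + β * partialRowSum n m)
      + σ * (α * entry (suc n) m + β * entry n m)
      ≈⟨ solve 7 (λ a b s x y z w →
           (a :* x :+ b :* y) :+ s :* (a :* z :+ b :* w) :=
           a :* (x :+ s :* z) :+ b :* (y :+ s :* w)) refl
           α β σ (partialRowSum (suc n) m) (partialRowSum n m) (entry (suc n) m) (entry n m) ⟩
    α * (partialRowSum (suc n) m + σ * entry (suc n) m) + β * (partialRowSum n m + σ * entry n m)
      ≈⟨ +-cong (*-congˡ (sum-last (signedEntry (suc n)) m)) (*-congˡ (sum-last (signedEntry n) m)) ⟨
    α * partialRowSum (suc n) (suc m) + β * partialRowSum n (suc m) ∎
    where
    σ : ℝ
    σ = (- 1ℝ) ^ m

  diagonal subdiagonal : ℕ → ℝ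
  diagonal n    = entry n n
  subdiagonal n = entry (suc n) n

  -- The defining rule involves `entry (2 + n) n`, which lies off the two diagonals; the column
  -- recurrence in its extreme case `k = n` leads back to them.
  subdiagonal-suc : ∀ n → subdiagonal (suc n) ≈
                    u * (α * subdiagonal n + β * diagonal n) + v * subdiagonal n
  subdiagonal-suc n = +-congʳ (*-congˡ (entry-recurrence {n} ℕ.≤-refl))

  -- The term `u * q + v * p` is the next diagonal entry, written out to make the form linear in the
  -- current pair.
  defectForm : (σ p q : ℝ) → ℝ
  defectForm σ p q = σ * (q - α * p - (u * q + v * p))

  defectForm-cong : ∀ σ {p p′ q q′} → p ≈ p′ → q ≈ q′ → defectForm σ p q ≈ defectForm σ p′ q′
  defectForm-cong σ p≈p′ q≈q′ = *-congˡ (+-cong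
    (+-cong q≈q′ (-‿cong (*-congˡ p≈p′)))
    (-‿cong (+-cong (*-congˡ q≈q′) (*-congˡ p≈p′))))

  defect : ℕ → ℝ
  defect n = defectForm ((- 1ℝ) ^ suc n) (diagonal (suc n)) (subdiagonal (suc n))

  -- Columns 0 to `n` cancel by the column recurrence. What remains is columns `n + 1` and `n + 2`
  -- of row `n + 2`, and `α` times column `n + 1` of row `n + 1`.
  alternatingRowSum-step : ∀ n → alternatingRowSum (2 ℕ.+ n) ≈
    α * alternatingRowSum (suc n) + β * alternatingRowSum n + defect n
  alternatingRowSum-step n = begin
    alternatingRowSum (2 ℕ.+ n)
      ≈⟨ sum-last (signedEntry (2 ℕ.+ n)) (2 ℕ.+ n) ⟩
    partialRowSum (2 ℕ.+ n) (2 ℕ.+ n) + - 1ℝ * σ * p″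
      ≈⟨ +-congʳ (sum-last (signedEntry (2 ℕ.+ n)) (suc n)) ⟩
    partialRowSum (2 ℕ.+ n) (suc n) + σ * q′ + - 1ℝ * σ * p″
      ≈⟨ +-congʳ (+-congʳ (partialRowSum-recurrence (suc n) ℕ.≤-refl)) ⟩
    α * partialRowSum (suc n) (suc n) + β * s̄ + σ * q′ + - 1ℝ * σ * p″
      -- `p″` can stay an atom, since it unfolds to the `u * q′ + v * p′` of `defectForm`.
      ≈⟨ solve 8 (λ a b s x y q p r →
           a :* x :+ b :* y :+ s :* q :+ :- con 1ℚ :* s :* r :=
           a :* (x :+ s :* p) :+ b :* y :+ s :* (q :- a :* p :- r)) refl
           α β σ (partialRowSum (suc n) (suc n)) s̄ q′ p′ p″ ⟩
    α * (partialRowSum (suc n) (suc n) + σ * p′) + β * s̄ + defect n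
      ≈⟨ +-congʳ (+-congʳ (*-congˡ (sum-last (signedEntry (suc n)) (suc n)))) ⟨
    α * alternatingRowSum (suc n) + β * s̄ + defect n ∎
    where
    σ s̄ p′ p″ q′ : ℝ
    σ  = (- 1ℝ) ^ suc n
    s̄  = alternatingRowSum n
    p′ = diagonal (suc n)
    p″ = diagonal (2 ℕ.+ n)
    q′ = subdiagonal (suc n)

  -- Cayley-Hamilton: the transition matrix M of the pair (p, q) satisfies M² = `𝓐` M + `𝓑`. Apply
  -- the linear form; the sign change at each step turns `𝓐` into `- 𝓐`.
  defect-recurrence : ∀ n → defect (2 ℕ.+ n) ≈ 𝓑 * defect n - 𝓐 * defect (suc n)
  defect-recurrence n = begin
    defect (2 ℕ.+ n)
      ≈⟨ defectForm-cong (- 1ℝ * (- 1ℝ * σ)) p‴≈ q‴≈ ⟩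
    defectForm (- 1ℝ * (- 1ℝ * σ)) (P (P p q) (Q p q)) (Q (P p q) (Q p q))
      ≈⟨ solve 7 (λ a b u v s p q →
           let P  = λ p q → u :* q :+ v :* p
               Q  = λ p q → u :* (a :* q :+ b :* p) :+ v :* q
               D  = λ s p q → s :* (q :- a :* p :- (u :* q :+ v :* p))
               s′ = :- con 1ℚ :* s
           in D (:- con 1ℚ :* s′) (P (P p q) (Q p q)) (Q (P p q) (Q p q)) :=
              :𝓑 a b u v :* D s p q :- :𝓐 a u v :* D s′ (P p q) (Q p q)) refl
           α β u v σ p q ⟩
    𝓑 * defect n - 𝓐 * defectForm (- 1ℝ * σ) (P p q) (Q p q)
      -- The next diagonal entry is `P p q` by definition; only the subdiagonal needs rewriting.
      ≈⟨ +-congˡ (-‿cong (*-congˡ (defectForm-cong (- 1ℝ * σ) refl q″≈))) ⟨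
    𝓑 * defect n - 𝓐 * defect (suc n) ∎
    where
    σ p q : ℝ
    σ = (- 1ℝ) ^ suc n
    p = diagonal (suc n)
    q = subdiagonal (suc n)
    P Q : ℝ → ℝ → ℝ
    P p q = u * q + v * p
    Q p q = u * (α * q + β * p) + v * q
    q″≈ : subdiagonal (2 ℕ.+ n) ≈ Q p q
    q″≈ = subdiagonal-suc (suc n)
    p‴≈ : diagonal (3 ℕ.+ n) ≈ P (P p q) (Q p q)
    p‴≈ = +-congʳ (*-congˡ q″≈)
    q‴≈ : subdiagonal (3 ℕ.+ n) ≈ Q (P p q) (Q p q)
    q‴≈ = trans (subdiagonal-suc (2 ℕ.+ n))
      (+-cong (*-congˡ (+-congʳ (*-congˡ q″≈))) (*-congˡ q″≈))

  alternatingRowSum-recurrence : ∀ n → alternatingRowSum (4 ℕ.+ n) ≈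
    (α - 𝓐) * alternatingRowSum (3 ℕ.+ n)
    + (β + α * 𝓐 + 𝓑) * alternatingRowSum (2 ℕ.+ n)
    - (α * 𝓑 - β * 𝓐) * alternatingRowSum (suc n) - β * 𝓑 * alternatingRowSum n
  alternatingRowSum-recurrence n = begin
    s̄ (4 ℕ.+ n)
      ≈⟨ alternatingRowSum-step (2 ℕ.+ n) ⟩
    α * s₃ + β * s₂ + defect (2 ℕ.+ n)
      ≈⟨ +-congˡ (defect-recurrence n) ⟩
    α * s₃ + β * s₂ + (𝓑 * defect n - 𝓐 * defect (suc n))
      ≈⟨ +-congˡ (+-cong (*-congˡ (defect-≈ n)) (-‿cong (*-congˡ (defect-≈ (suc n))))) ⟩
    α * s₃ + β * s₂ + (𝓑 * (s₂ - (α * s₁ + β * s₀)) - 𝓐 * (s₃ - (α * s₂ + β * s₁)))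
      -- With `𝓐` and `𝓑` as atoms, this is just the expansion of the product of the two quadratics.
      ≈⟨ solve 8 (λ a b A B s₀ s₁ s₂ s₃ →
           a :* s₃ :+ b :* s₂
             :+ (B :* (s₂ :- (a :* s₁ :+ b :* s₀)) :- A :* (s₃ :- (a :* s₂ :+ b :* s₁))) :=
           (a :- A) :* s₃ :+ (b :+ a :* A :+ B) :* s₂
             :- (a :* B :- b :* A) :* s₁ :- b :* B :* s₀) refl
           α β 𝓐 𝓑 s₀ s₁ s₂ s₃ ⟩
    (α - 𝓐) * s₃ + (β + α * 𝓐 + 𝓑) * s₂ - (α * 𝓑 - β * 𝓐) * s₁ - β * 𝓑 * s₀ ∎
    where
    s̄ : ℕ → ℝ
    s̄ = alternatingRowSum
    s₀ s₁ s₂ s₃ : ℝ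
    s₀ = s̄ n
    s₁ = s̄ (suc n)
    s₂ = s̄ (2 ℕ.+ n)
    s₃ = s̄ (3 ℕ.+ n)
    defect-≈ : ∀ m → defect m ≈ s̄ (2 ℕ.+ m) - (α * s̄ (suc m) + β * s̄ m)
    defect-≈ m = begin
      defect m
        ≈⟨ solve 2 (λ x d → d := x :+ d :- x) refl (α * s̄ (suc m) + β * s̄ m) (defect m) ⟩
      α * s̄ (suc m) + β * s̄ m + defect m - (α * s̄ (suc m) + β * s̄ m)
        ≈⟨ +-congʳ (alternatingRowSum-step m) ⟨
      s̄ (2 ℕ.+ m) - (α * s̄ (suc m) + β * s̄ m) ∎

theorem7 : (a₀ a₁ α β u v : ℝ) → α * β ≉ 0ℝ → u * v ≉ 0ℝ → ∣ a₀ ∣ + ∣ a₁ ∣ ≉ 0ℝ →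
    let s̄ = BinaryBinomialInterpolatedTriangle.alternatingRowSum a₀ a₁ α β u v
        𝓐 = u * α + 2ℝ * v
        𝓑 = u ^ 2 * β - u * v * α - v ^ 2
    in (n : ℕ) → n ≥ 4 →
       s̄ n ≈ (α - 𝓐) * s̄ (n ∸ 1) + (β + α * 𝓐 + 𝓑) * s̄ (n ∸ 2)
             - (α * 𝓑 - β * 𝓐) * s̄ (n ∸ 3) - β * 𝓑 * s̄ (n ∸ 4)
-- Exposing four successors lets every `∸` compute.
theorem7 a₀ a₁ α β u v _ _ _ (suc (suc (suc (suc n)))) (s≤s (s≤s (s≤s (s≤s _)))) =
  alternatingRowSum-recurrence a₀ a₁ α β u v n
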